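{- Let $N\ge 2$ and $m\ge 1$ be integers and let $x^{(r,s)}_k$ ($1\le r,s\le N$, $1\le k\le m$) be elements of a commutative ring; set $x^{(r,s)}_{m+1}=0$ for all $1\le r,s\le N$. Let $B(N,m)$ be the $Nm\times Nm$ matrix which, as an $N\times N$ block matrix with $m\times m$ blocks, has $(r,s)$ block $B_m(x^{(r,s)}_1,\dots,x^{(r,s)}_m)$. Then $$\det(B(N,m))=\prod_{i=1}^{m}\det(X_{(i,i+1)}).$$
   Context: For elements $x_1,\dots,x_m$, $B_m(x_1,\dots,x_m)$ is the $m\times m$ matrix whose $(p,q)$ entry is $x_{\max(p,q)}$ (top-left entry $x_1$, last row and column constantly $x_m$). For $1\le i\le m$, $X_{(i,i+1)}$ is the $N\times N$ matrix whose $(r,s)$ entry is $x^{(r,s)}_i-x^{(r,s)}_{i+1}$. -}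

module Defs where

open import Algebra.Bundles using (CommutativeRing)
open import Data.Fin.Base
  using (Fin; zero; suc; toℕ; fromℕ; inject₁; punchIn; quotient; remainder)
open import Data.Fin.Properties using (≤-totalOrder)
open import Data.Nat.Base as ℕ using (ℕ; zero; suc)
open import Data.Vec.Functional using (Vector; insertAt)
import Algebra.Construct.NaturalChoice.Max as Max
import Algebra.Properties.CommutativeMonoid.Sum as MonoidSum
import Algebra.Properties.Semiring.Exp as Exp

-- Fin is 0-based: `k : Fin m` stands for the index k + 1 of 1, …, m.

module Matrices {c ℓ} (R : CommutativeRing c ℓ) where

  open CommutativeRing R hiding (zero)
  open MonoidSum +-commutativeMonoid using (sum)
  open MonoidSum *-commutativeMonoid public using () renaming (sum to product)
  open Exp semiring using (_^_)

  Matrix : ℕ → Set c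
  Matrix n = Fin n → Fin n → Carrier

  -- Delete the first row and column k.
  minor : ∀ {n} → Matrix (suc n) → Fin (suc n) → Matrix n
  minor A k i j = A (suc i) (punchIn k j)

  -- Cofactor expansion along the first row; the empty determinant is 1.
  det : ∀ {n} → Matrix n → Carrier
  det {zero}  A = 1#
  det {suc n} A = sum (λ k → (- 1#) ^ toℕ k * (A zero k * det (minor A k)))

  -- Index i of the assembled matrix is m * r + p, where r = quotient m i is
  -- the block and p = remainder m i the position inside that block.
  fromBlocks : ∀ N m → (Fin N → Fin N → Matrix m) → Matrix (N ℕ.* m)
  fromBlocks N m A i j =
    A (quotient {N} m i) (quotient {N} m j) (remainder {N} m i) (remainder {N} m j)

  Bₘ : ∀ {m} → Vector Carrier m → Matrix m
  Bₘ {m} x p q = x (p ⊔ q)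
    where open Max (≤-totalOrder m) using (_⊔_)

  B : ∀ N m → (Fin N → Fin N → Vector Carrier m) → Matrix (N ℕ.* m)
  B N m x = fromBlocks N m (λ r s → Bₘ (x r s))

  -- (x₁, …, xₘ) ↦ (x₁, …, xₘ, 0), i.e. the convention xₘ₊₁ = 0.
  extend : ∀ {m} → Vector Carrier m → Vector Carrier (suc m)
  extend {m} x = insertAt x (fromℕ m) 0#

  -- X x i is X_(i,i+1), with (r,s) entry x^(r,s)_i - x^(r,s)_(i+1).
  X : ∀ {N m} → (Fin N → Fin N → Vector Carrier m) → Fin m → Matrix N
  X x i r s = extend (x r s) (inject₁ i) - extend (x r s) (suc i)

{-# OPTIONS --safe #-}
module Submission where

-- Subtracting from each column (s,q) of B the column (s,q+1) leaves a matrix whose (r,s) block has,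
-- in column q, the (r,s) entry of X_(q,q+1) on and above the diagonal and 0 below it.  For fixed q,
-- the determinant is an alternating multilinear function of the columns (1,q), …, (N,q), so
-- det X_(q,q+1) factors out and X_(q,q+1) may be replaced by the identity; once this is done for
-- all q, the matrix is upper unitriangular.  The factoring rests on f(E A) = f(E) det A for
-- alternating f.

open import Defs
open import Algebra.Bundles using (CommutativeRing)
open import Data.Bool.Base using (true; false; if_then_else_)
open import Data.Fin.Base as Fin
  using (Fin; zero; suc; toℕ; fromℕ; fromℕ<; inject₁; punchIn; punchOut; quotient; remainder; combine)
open import Data.Fin.Properties as Fin
  using (_≟_; _≤?_; punchIn-injective; punchInᵢ≢i; punchIn-punchOut; toℕ-combine; toℕ-fromℕ<;
         toℕ-injective; toℕ<n; toℕ-inject₁; combine-remQuot; remQuot-combine; ≤-totalOrder)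
open import Data.Nat.Base as ℕ using (ℕ; zero; suc; _≤_; s≤s; z≤n)
import Data.Nat.Properties as ℕ
open import Data.Product.Base using (∃; _×_; _,_; proj₁; proj₂)
open import Data.Sum.Base using (_⊎_; inj₁; inj₂)
open import Data.Vec.Functional using (Vector; _∷_; tail; insertAt; removeAt)
open import Data.Vec.Functional.Properties using (insertAt-lookup; insertAt-removeAt)
open import Function.Base using (_∘_; flip)
open import Level using (_⊔_)
open import Relation.Binary.PropositionalEquality.Core as ≡ using (_≡_; _≢_)
open import Relation.Nullary using (Dec; yes; no; does; ¬_; contradiction)
import Algebra.Construct.NaturalChoice.Max as Max

-- Neighbouring indices under insertion and deletion.

insertAt-next : ∀ {a} {A : Set a} {n} (xs : Vector A n) (j : Fin n) (v : A) →
                insertAt xs (inject₁ j) v (suc j) ≡ xs j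
insertAt-next xs zero    v = ≡.refl
insertAt-next xs (suc j) v = insertAt-next (tail xs) j v

-- Deleting a third column leaves two neighbouring columns neighbours, so the minors in a cofactor
-- expansion inherit an equal adjacent pair.
punchOut-adjacent : ∀ {n} {l p q : Fin (suc n)} (l≢p : l ≢ p) (l≢q : l ≢ q) →
                    toℕ q ≡ suc (toℕ p) → toℕ (punchOut l≢q) ≡ suc (toℕ (punchOut l≢p))
punchOut-adjacent {_} {zero} {zero} l≢p l≢q eq = contradiction ≡.refl l≢p
punchOut-adjacent {_} {zero} {suc p} {suc q} l≢p l≢q eq = ℕ.suc-injective eq
punchOut-adjacent {_} {suc zero} {zero} {suc zero} l≢p l≢q eq = contradiction ≡.refl l≢q
punchOut-adjacent {suc (suc n)} {suc (suc l)} {zero} {suc zero} l≢p l≢q eq = ≡.refl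
punchOut-adjacent {suc n} {suc l} {suc p} {suc q} l≢p l≢q eq =
  ≡.cong suc (punchOut-adjacent (l≢p ∘ ≡.cong suc) (l≢q ∘ ≡.cong suc) (ℕ.suc-injective eq))

-- Deleting either of two neighbouring columns leaves the same list of columns, up to the one place
-- where the survivor of the pair stands. If the two columns are equal, both minors therefore
-- coincide.
punchIn-adjacent : ∀ {n} {p q : Fin (suc n)} → toℕ q ≡ suc (toℕ p) → ∀ j →
                   punchIn p j ≡ punchIn q j ⊎ (punchIn p j ≡ q × punchIn q j ≡ p)
punchIn-adjacent {p = zero}  {suc zero} eq zero    = inj₂ (≡.refl , ≡.refl)
punchIn-adjacent {p = zero}  {suc zero} eq (suc j) = inj₁ ≡.refl
punchIn-adjacent {p = suc p} {suc q}    eq zero    = inj₁ ≡.refl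
punchIn-adjacent {p = suc p} {suc q}    eq (suc j) with punchIn-adjacent (ℕ.suc-injective eq) j
... | inj₁ e       = inj₁ (≡.cong suc e)
... | inj₂ (e , d) = inj₂ (≡.cong suc e , ≡.cong suc d)

module Determinants {c ℓ} (R : CommutativeRing c ℓ) where

  open CommutativeRing R hiding (zero)
  open Matrices R
  open import Algebra.Properties.Ring ring using (-1*x≈-x; -0#≈0#)
  open import Algebra.Properties.AbelianGroup +-abelianGroup using (inverseˡ-unique)
  open import Algebra.Properties.Semiring.Sum semiring
    using (sum; sum-cong-≋; sum-remove; sum-replicate-zero; ∑-distrib-+; *-distribˡ-sum)
  open import Algebra.Properties.Semiring.Exp semiring using (_^_)
  open import Algebra.Solver.Ring.NaturalCoefficients.Default commutativeSemiring
    using (solve; _:=_; _:+_; _:*_)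
  open import Relation.Binary.Reasoning.Setoid setoid

  -- Rectangular matrices and functions of their columns.

  -- Inductions below split off columns while the number of rows stays fixed, so square matrices
  -- would not suffice.
  RectMatrix : ℕ → ℕ → Set c
  RectMatrix k n = Fin k → Fin n → Carrier

  infix 4 _≋_
  _≋_ : ∀ {k n} → RectMatrix k n → RectMatrix k n → Set ℓ
  A ≋ B = ∀ r j → A r j ≈ B r j

  infixr 5 _∷ᶜ_
  _∷ᶜ_ : ∀ {k n} → Vector Carrier k → RectMatrix k n → RectMatrix k (suc n)
  (v ∷ᶜ A) r = v r ∷ A r

  column : ∀ {k n} → RectMatrix k n → Fin n → Vector Carrier k
  column A j r = A r j

  tailᶜ : ∀ {k n} → RectMatrix k (suc n) → RectMatrix k n
  tailᶜ A r = tail (A r)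

  -- Matrices are functions, so this holds entrywise only; splitting the argument of f into head and
  -- tail then relies on the field `cong` of `IsAlternating`.
  ∷ᶜ-η : ∀ {k n} (A : RectMatrix k (suc n)) → A ≋ column A zero ∷ᶜ tailᶜ A
  ∷ᶜ-η A r zero    = refl
  ∷ᶜ-η A r (suc j) = refl

  ∷ᶜ-congˡ : ∀ {k n} (v : Vector Carrier k) {A B : RectMatrix k n} → A ≋ B → v ∷ᶜ A ≋ v ∷ᶜ B
  ∷ᶜ-congˡ v A≋B r zero    = refl
  ∷ᶜ-congˡ v A≋B r (suc j) = A≋B r j

  sum-zero : ∀ {n} {t : Vector Carrier n} → (∀ l → t l ≈ 0#) → sum t ≈ 0#
  sum-zero {n} t≈0 = trans (sum-cong-≋ t≈0) (sum-replicate-zero n)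

  -- The shape of a cofactor expansion with two equal neighbouring columns: only their two terms can
  -- survive, and these cancel.
  sum-adjacent-cancel : ∀ {n} (t : Vector Carrier n) {p q} → toℕ q ≡ suc (toℕ p) →
                        t p + t q ≈ 0# → (∀ l → l ≢ p → l ≢ q → t l ≈ 0#) → sum t ≈ 0#
  sum-adjacent-cancel t {zero} {suc zero} eq cancel others = begin
    t zero + (t (suc zero) + sum (λ l → t (suc (suc l))))  ≈⟨ +-assoc _ _ _ ⟨
    t zero + t (suc zero) + sum (λ l → t (suc (suc l)))
      ≈⟨ +-cong cancel (sum-zero (λ l → others (suc (suc l)) (λ ()) (λ ()))) ⟩
    0# + 0#                                        ≈⟨ +-identityˡ 0# ⟩
    0#                                             ∎
  sum-adjacent-cancel t {suc p} {suc q} eq cancel others = begin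
    t zero + sum (t ∘ suc)
      ≈⟨ +-cong (others zero (λ ()) (λ ()))
                (sum-adjacent-cancel (t ∘ suc) (ℕ.suc-injective eq) cancel
                  (λ l l≢p l≢q → others (suc l) (l≢p ∘ Fin.suc-injective) (l≢q ∘ Fin.suc-injective))) ⟩
    0# + 0#                 ≈⟨ +-identityˡ 0# ⟩
    0#                      ∎

  -- Hypotheses are relational (A agrees with B off column p, …) so that no column-update operation
  -- is needed.
  record IsAlternating {k n} (f : RectMatrix k n → Carrier) : Set (c ⊔ ℓ) where
    field
      cong     : ∀ {A B} → A ≋ B → f A ≈ f B
      linear   : ∀ p x A B C →
                 (∀ r j → j ≢ p → A r j ≈ B r j) → (∀ r j → j ≢ p → A r j ≈ C r j) →
                 (∀ r → A r p ≈ B r p + x * C r p) → f A ≈ f B + x * f C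
      adjacent : ∀ A {p q} → toℕ q ≡ suc (toℕ p) → (∀ r → A r p ≈ A r q) → f A ≈ 0#

  -- The determinant as an alternating multilinear function of its columns.

  det-cong : ∀ {n} {A B : Matrix n} → A ≋ B → det A ≈ det B
  det-cong {zero}  A≋B = refl
  det-cong {suc n} A≋B = sum-cong-≋ λ l →
    *-congˡ {(- 1#) ^ toℕ l} (*-cong (A≋B zero l) (det-cong (λ i j → A≋B (suc i) (punchIn l j))))

  -- Column p enters term l of the expansion exactly once: through the entry if l = p, and otherwise
  -- through the minor, where it has become column `punchOut l≢p` and the induction hypothesis
  -- applies.
  det-linear : ∀ {n} p x (A B C : Matrix n) →
               (∀ r j → j ≢ p → A r j ≈ B r j) → (∀ r j → j ≢ p → A r j ≈ C r j) →
               (∀ r → A r p ≈ B r p + x * C r p) → det A ≈ det B + x * det C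
  det-linear {suc n} p x A B C A~B A~C Aₚ = begin
    sum (term A)                                   ≈⟨ sum-cong-≋ split ⟩
    sum (λ l → term B l + x * term C l)            ≈⟨ ∑-distrib-+ (term B) (λ l → x * term C l) ⟩
    sum (term B) + sum (λ l → x * term C l)        ≈⟨ +-congˡ (*-distribˡ-sum x (term C)) ⟨
    sum (term B) + x * sum (term C)                ∎
    where
    term : Matrix (suc n) → Fin (suc n) → Carrier
    term M l = (- 1#) ^ toℕ l * (M zero l * det (minor M l))
    split : ∀ l → term A l ≈ term B l + x * term C l
    split l with l ≟ p
    ... | yes ≡.refl = begin
      s * (A zero l * det (minor A l))
        ≈⟨ *-congˡ (*-congʳ (Aₚ zero)) ⟩
      s * ((B zero l + x * C zero l) * det (minor A l))
        ≈⟨ solve 5 (λ s b x c d → s :* ((b :+ x :* c) :* d) := s :* (b :* d) :+ x :* (s :* (c :* d)))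
             refl s (B zero l) x (C zero l) (det (minor A l)) ⟩
      s * (B zero l * det (minor A l)) + x * (s * (C zero l * det (minor A l)))
        ≈⟨ +-cong (*-congˡ (*-congˡ (det-cong (λ i j → A~B (suc i) _ (punchInᵢ≢i l j)))))
                  (*-congˡ (*-congˡ (*-congˡ (det-cong (λ i j → A~C (suc i) _ (punchInᵢ≢i l j)))))) ⟩
      term B l + x * term C l ∎
      where s = (- 1#) ^ toℕ l
    ... | no l≢p = begin
      s * (A zero l * det (minor A l))
        ≈⟨ *-congˡ (*-congˡ (det-linear (punchOut l≢p) x (minor A l) (minor B l) (minor C l)
             (λ i j → A~B (suc i) _ ∘ off j) (λ i j → A~C (suc i) _ ∘ off j) on)) ⟩
      s * (A zero l * (det (minor B l) + x * det (minor C l)))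
        ≈⟨ solve 5 (λ s a b x c → s :* (a :* (b :+ x :* c)) := s :* (a :* b) :+ x :* (s :* (a :* c)))
             refl s (A zero l) (det (minor B l)) x (det (minor C l)) ⟩
      s * (A zero l * det (minor B l)) + x * (s * (A zero l * det (minor C l)))
        ≈⟨ +-cong (*-congˡ (*-congʳ (A~B zero l l≢p))) (*-congˡ (*-congˡ (*-congʳ (A~C zero l l≢p)))) ⟩
      term B l + x * term C l ∎
      where
      s = (- 1#) ^ toℕ l
      off : ∀ j → j ≢ punchOut l≢p → punchIn l j ≢ p
      off j j≢ eq = j≢ (punchIn-injective l _ _ (≡.trans eq (≡.sym (punchIn-punchOut l≢p))))
      on : ∀ i → minor A l i (punchOut l≢p) ≈
                 minor B l i (punchOut l≢p) + x * minor C l i (punchOut l≢p)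
      on i = ≡.subst (λ q → A (suc i) q ≈ B (suc i) q + x * C (suc i) q)
                     (≡.sym (punchIn-punchOut l≢p)) (Aₚ (suc i))

  det-adjacent : ∀ {n} (A : Matrix n) {p q} → toℕ q ≡ suc (toℕ p) →
                 (∀ r → A r p ≈ A r q) → det A ≈ 0#
  det-adjacent {suc n} A {p} {q} eq Aₚ≈A_q = sum-adjacent-cancel term eq cancel others
    where
    term : Fin (suc n) → Carrier
    term l = (- 1#) ^ toℕ l * (A zero l * det (minor A l))
    minors : minor A q ≋ minor A p
    minors i j with punchIn-adjacent {p = p} {q} eq j
    ... | inj₁ e       = reflexive (≡.cong (A (suc i)) (≡.sym e))
    ... | inj₂ (e , d) = trans (reflexive (≡.cong (A (suc i)) d))
                           (trans (Aₚ≈A_q (suc i)) (reflexive (≡.cong (A (suc i)) (≡.sym e))))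
    cancel : term p + term q ≈ 0#
    cancel = begin
      term p + term q
        -- Since q follows p, the sign at q is `- 1#` times the sign at p, while entries and minors
        -- agree.
        ≈⟨ +-congˡ (*-cong (reflexive (≡.cong ((- 1#) ^_) eq))
                           (*-cong (sym (Aₚ≈A_q zero)) (det-cong minors))) ⟩
      term p + - 1# * (- 1#) ^ toℕ p * (A zero p * det (minor A p))  ≈⟨ +-congˡ (*-assoc _ _ _) ⟩
      term p + - 1# * term p                                         ≈⟨ +-congˡ (-1*x≈-x (term p)) ⟩
      term p - term p                                                ≈⟨ -‿inverseʳ (term p) ⟩
      0#                                                             ∎
    others : ∀ l → l ≢ p → l ≢ q → term l ≈ 0#
    others l l≢p l≢q = begin
      (- 1#) ^ toℕ l * (A zero l * det (minor A l))
        ≈⟨ *-congˡ (*-congˡ (det-adjacent (minor A l) (punchOut-adjacent l≢p l≢q eq) λ r →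
             ≡.subst₂ (λ u v → A (suc r) u ≈ A (suc r) v)
               (≡.sym (punchIn-punchOut l≢p)) (≡.sym (punchIn-punchOut l≢q)) (Aₚ≈A_q (suc r)))) ⟩
      (- 1#) ^ toℕ l * (A zero l * 0#)  ≈⟨ *-congˡ (zeroʳ _) ⟩
      (- 1#) ^ toℕ l * 0#               ≈⟨ zeroʳ _ ⟩
      0#                                ∎

  det-isAlternating : ∀ {n} → IsAlternating {n} {n} det
  det-isAlternating = record { cong = det-cong ; linear = det-linear ; adjacent = det-adjacent }

  -- Column operations for arbitrary alternating functions.

  open IsAlternating

  -- The induction step for all arguments that proceed column by column: the head is frozen and f
  -- becomes an alternating function of the tail.
  prefix : ∀ {k n} {f : RectMatrix k (suc n) → Carrier} (v : Vector Carrier k) →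
           IsAlternating f → IsAlternating (λ A → f (v ∷ᶜ A))
  prefix v alt .cong A≋B = cong alt (∷ᶜ-congˡ v A≋B)
  prefix v alt .linear p x A B C A~B A~C Aₚ = linear alt (suc p) x _ _ _
    (λ { r zero _ → refl ; r (suc j) j≢p → A~B r j (j≢p ∘ ≡.cong suc) })
    (λ { r zero _ → refl ; r (suc j) j≢p → A~C r j (j≢p ∘ ≡.cong suc) })
    Aₚ
  prefix v alt .adjacent A eq Aₚ≈A_q = adjacent alt (v ∷ᶜ A) (≡.cong suc eq) Aₚ≈A_q

  -- A zero column equals itself minus itself, so linearity with all three matrices equal to A gives
  -- f A = f A - f A.
  zero-column : ∀ {k n} {f : RectMatrix k n → Carrier} → IsAlternating f →
                ∀ A p → (∀ r → A r p ≈ 0#) → f A ≈ 0#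
  zero-column {f = f} alt A p Aₚ≈0 = begin
    f A               ≈⟨ linear alt p (- 1#) A A A (λ _ _ _ → refl) (λ _ _ _ → refl) split ⟩
    f A + - 1# * f A  ≈⟨ +-congˡ (-1*x≈-x (f A)) ⟩
    f A - f A         ≈⟨ -‿inverseʳ (f A) ⟩
    0#                ∎
    where
    split : ∀ r → A r p ≈ A r p + - 1# * A r p
    split r = begin
      A r p                 ≈⟨ Aₚ≈0 r ⟩
      0#                    ≈⟨ -‿inverseʳ (A r p) ⟨
      A r p - A r p         ≈⟨ +-congˡ (-1*x≈-x (A r p)) ⟨
      A r p + - 1# * A r p  ∎

  linear-head : ∀ {k n} {f : RectMatrix k (suc n) → Carrier} → IsAlternating f →
                ∀ {u} v x w A → (∀ r → u r ≈ v r + x * w r) →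
                f (u ∷ᶜ A) ≈ f (v ∷ᶜ A) + x * f (w ∷ᶜ A)
  linear-head alt v x w A u≈ = linear alt zero x _ _ _ agree agree u≈
    where
    agree : ∀ {u v : Vector Carrier _} r j → j ≢ zero → (u ∷ᶜ A) r j ≈ (v ∷ᶜ A) r j
    agree r zero    0≢0 = contradiction ≡.refl 0≢0
    agree r (suc j) _   = refl

  -- Polarization: f vanishes when its first two columns are both v + w, and expanding leaves only
  -- the two mixed terms.
  swap : ∀ {k n} {f : RectMatrix k (suc (suc n)) → Carrier} → IsAlternating f →
         ∀ v w A → f (v ∷ᶜ w ∷ᶜ A) ≈ - f (w ∷ᶜ v ∷ᶜ A)
  swap {f = f} alt v w A = inverseˡ-unique _ _ (begin
    f (v ∷ᶜ w ∷ᶜ A) + f (w ∷ᶜ v ∷ᶜ A)            ≈⟨ +-cong first second ⟨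
    f (v ∷ᶜ u ∷ᶜ A) + f (w ∷ᶜ u ∷ᶜ A)            ≈⟨ +-congˡ (*-identityˡ _) ⟨
    f (v ∷ᶜ u ∷ᶜ A) + 1# * f (w ∷ᶜ u ∷ᶜ A)
      ≈⟨ linear-head alt v 1# w (u ∷ᶜ A) (λ r → +-congˡ (sym (*-identityˡ (w r)))) ⟨
    f (u ∷ᶜ u ∷ᶜ A)                              ≈⟨ equal u ⟩
    0#                                           ∎)
    where
    u : Vector Carrier _
    u r = v r + w r
    equal : ∀ t → f (t ∷ᶜ t ∷ᶜ A) ≈ 0#
    equal t = adjacent alt (t ∷ᶜ t ∷ᶜ A) {zero} {suc zero} ≡.refl (λ _ → refl)
    expand : ∀ t → f (t ∷ᶜ u ∷ᶜ A) ≈ f (t ∷ᶜ v ∷ᶜ A) + f (t ∷ᶜ w ∷ᶜ A)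
    expand t = trans
      (linear-head (prefix t alt) v 1# w A (λ r → +-congˡ (sym (*-identityˡ (w r)))))
      (+-congˡ (*-identityˡ _))
    first : f (v ∷ᶜ u ∷ᶜ A) ≈ f (v ∷ᶜ w ∷ᶜ A)
    first = trans (expand v) (trans (+-congʳ (equal v)) (+-identityˡ _))
    second : f (w ∷ᶜ u ∷ᶜ A) ≈ f (w ∷ᶜ v ∷ᶜ A)
    second = trans (expand w) (trans (+-congˡ (equal w)) (+-identityʳ _))

  insertColumn : ∀ {k n} → RectMatrix k n → Fin (suc n) → Vector Carrier k → RectMatrix k (suc n)
  insertColumn A i v r = insertAt (A r) i (v r)

  -- The head travels to place i by i swaps of neighbours, each contributing a sign.
  move-head : ∀ {k n} {f : RectMatrix k (suc n) → Carrier} → IsAlternating f →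
              ∀ i v A → f (v ∷ᶜ A) ≈ (- 1#) ^ toℕ i * f (insertColumn A i v)
  move-head {f = f} alt zero v A = trans
    (cong alt (λ { r zero → refl ; r (suc j) → refl })) (sym (*-identityˡ _))
  move-head {n = suc n} {f} alt (suc i) v A = begin
    f (v ∷ᶜ A)                     ≈⟨ cong alt (∷ᶜ-congˡ v (∷ᶜ-η A)) ⟩
    f (v ∷ᶜ a ∷ᶜ A′)               ≈⟨ swap alt v a A′ ⟩
    - f (a ∷ᶜ v ∷ᶜ A′)             ≈⟨ -‿cong (move-head (prefix a alt) i v A′) ⟩
    - (s * f (a ∷ᶜ insertColumn A′ i v))
      ≈⟨ -‿cong (*-congˡ (cong alt (λ { r zero → refl ; r (suc j) → refl }))) ⟩
    - (s * f (insertColumn A (suc i) v))     ≈⟨ -1*x≈-x _ ⟨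
    - 1# * (s * f (insertColumn A (suc i) v)) ≈⟨ *-assoc _ _ _ ⟨
    - 1# * s * f (insertColumn A (suc i) v)  ∎
    where
    a = column A zero
    A′ = tailᶜ A
    s = (- 1#) ^ toℕ i

  repeated-head : ∀ {k n} {f : RectMatrix k (suc n) → Carrier} → IsAlternating f →
                  ∀ v A j → (∀ r → A r j ≈ v r) → f (v ∷ᶜ A) ≈ 0#
  repeated-head {f = f} alt v A j Aⱼ≈v = begin
    -- Inserting v at `inject₁ j` puts it directly before its copy, which then stands at `suc j`.
    f (v ∷ᶜ A)                                          ≈⟨ move-head alt (inject₁ j) v A ⟩
    (- 1#) ^ toℕ (inject₁ j) * f (insertColumn A (inject₁ j) v)
      ≈⟨ *-congˡ (adjacent alt _ (≡.cong suc (≡.sym (toℕ-inject₁ j))) (λ r → begin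
           insertColumn A (inject₁ j) v r (inject₁ j)  ≡⟨ insertAt-lookup (A r) (inject₁ j) (v r) ⟩
           v r                                         ≈⟨ Aⱼ≈v r ⟨
           A r j                                       ≡⟨ insertAt-next (A r) j (v r) ⟨
           insertColumn A (inject₁ j) v r (suc j)      ∎)) ⟩
    (- 1#) ^ toℕ (inject₁ j) * 0#                       ≈⟨ zeroʳ _ ⟩
    0#                                                  ∎

  repeated-column : ∀ {k n} {f : RectMatrix k n → Carrier} → IsAlternating f →
                    ∀ A {p q} → p Fin.< q → (∀ r → A r p ≈ A r q) → f A ≈ 0#
  repeated-column alt A {zero} {suc q} _ Aₚ≈A_q = trans (cong alt (∷ᶜ-η A))
    (repeated-head alt _ (tailᶜ A) q (sym ∘ Aₚ≈A_q))
  repeated-column alt A {suc p} {suc q} (s≤s p<q) Aₚ≈A_q = trans (cong alt (∷ᶜ-η A))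
    (repeated-column (prefix _ alt) (tailᶜ A) p<q Aₚ≈A_q)

  -- All columns change at once, each by a multiple of a column of the original A. The tail is
  -- restored to A before the head is treated, so the column added to the head really occurs in the
  -- tail and the extra term has a repeated column.
  add-later-columns : ∀ {k n} {f : RectMatrix k n → Carrier} → IsAlternating f →
    ∀ A B → (∀ j → (∀ r → B r j ≈ A r j) ⊎
                   (∃ λ q → j Fin.< q × ∃ λ x → ∀ r → B r j ≈ A r j + x * A r q)) →
    f B ≈ f A
  add-later-columns {n = zero} alt A B B~A = cong alt (λ r ())
  add-later-columns {n = suc n} {f} alt A B B~A = begin
    f B             ≈⟨ cong alt (∷ᶜ-η B) ⟩
    f (b ∷ᶜ tailᶜ B) ≈⟨ add-later-columns (prefix b alt) (tailᶜ A) (tailᶜ B) later ⟩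
    f (b ∷ᶜ tailᶜ A) ≈⟨ head-step (B~A zero) ⟩
    f (a ∷ᶜ tailᶜ A) ≈⟨ cong alt (∷ᶜ-η A) ⟨
    f A             ∎
    where
    a = column A zero
    b = column B zero
    later : ∀ j → (∀ r → B r (suc j) ≈ A r (suc j)) ⊎
                  (∃ λ q → j Fin.< q × ∃ λ x → ∀ r → B r (suc j) ≈ A r (suc j) + x * A r (suc q))
    later j with B~A (suc j)
    ... | inj₁ e                          = inj₁ e
    ... | inj₂ (suc q , s≤s j<q , x , e)  = inj₂ (q , j<q , x , e)
    head-step : (∀ r → b r ≈ a r) ⊎ (∃ λ q → 0 ℕ.< toℕ q × ∃ λ x → ∀ r → b r ≈ a r + x * A r q) →
                f (b ∷ᶜ tailᶜ A) ≈ f (a ∷ᶜ tailᶜ A)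
    head-step (inj₁ e) = cong alt (λ { r zero → e r ; r (suc j) → refl })
    head-step (inj₂ (suc q , _ , x , e)) = begin
      f (b ∷ᶜ tailᶜ A)
        ≈⟨ linear-head alt a x (column A (suc q)) (tailᶜ A) e ⟩
      f (a ∷ᶜ tailᶜ A) + x * f (column A (suc q) ∷ᶜ tailᶜ A)
        ≈⟨ +-congˡ (*-congˡ (repeated-head alt _ (tailᶜ A) q (λ _ → refl))) ⟩
      f (a ∷ᶜ tailᶜ A) + x * 0#  ≈⟨ +-congˡ (zeroʳ x) ⟩
      f (a ∷ᶜ tailᶜ A) + 0#      ≈⟨ +-identityʳ _ ⟩
      f (a ∷ᶜ tailᶜ A)           ∎

  -- Meant for an f whose frozen first column is v: multiples of v can then be added to all other
  -- columns. The vanishing is a hypothesis on f so that it survives freezing further columns.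
  add-annihilated : ∀ {k n} {f : RectMatrix k n → Carrier} → IsAlternating f →
    ∀ (v : Vector Carrier k) → (∀ A j → (∀ r → A r j ≈ v r) → f A ≈ 0#) →
    ∀ (y : Vector Carrier n) A B → (∀ r j → B r j ≈ A r j + y j * v r) → f B ≈ f A
  add-annihilated {n = zero} alt v kill y A B B≈ = cong alt (λ r ())
  add-annihilated {n = suc n} {f} alt v kill y A B B≈ = begin
    f B              ≈⟨ cong alt (∷ᶜ-η B) ⟩
    f (b ∷ᶜ tailᶜ B)  ≈⟨ linear-head alt a (y zero) v (tailᶜ B) (λ r → B≈ r zero) ⟩
    f (a ∷ᶜ tailᶜ B) + y zero * f (v ∷ᶜ tailᶜ B)
      ≈⟨ +-cong (add-annihilated (prefix a alt) v (λ C j → kill (a ∷ᶜ C) (suc j)) (tail y)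
                  (tailᶜ A) (tailᶜ B) (λ r j → B≈ r (suc j)))
                (*-congˡ (kill (v ∷ᶜ tailᶜ B) zero (λ _ → refl))) ⟩
    f (a ∷ᶜ tailᶜ A) + y zero * 0#  ≈⟨ +-congˡ (zeroʳ _) ⟩
    f (a ∷ᶜ tailᶜ A) + 0#           ≈⟨ +-identityʳ _ ⟩
    f (a ∷ᶜ tailᶜ A)                ≈⟨ cong alt (∷ᶜ-η A) ⟨
    f A                             ∎
    where
    a = column A zero
    b = column B zero

  -- Alternating functions of a matrix product.

  infixl 7 _⊗_
  _⊗_ : ∀ {k n l} → RectMatrix k n → RectMatrix n l → RectMatrix k l
  (E ⊗ A) r j = sum (λ i → E r i * A i j)

  expand-head : ∀ {k l n} {f : RectMatrix k (suc n) → Carrier} → IsAlternating f →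
                ∀ (E : RectMatrix k l) (y : Vector Carrier l) A →
                f ((λ r → sum (λ i → E r i * y i)) ∷ᶜ A) ≈ sum (λ i → y i * f (column E i ∷ᶜ A))
  -- The empty combination is the zero column.
  expand-head {l = zero} alt E y A = zero-column alt _ zero (λ _ → refl)
  expand-head {l = suc l} {f = f} alt E y A = begin
    f ((λ r → sum (λ i → E r i * y i)) ∷ᶜ A)
      ≈⟨ linear-head alt (λ r → sum (λ i → E r (suc i) * y (suc i))) (y zero) (column E zero) A
           (λ r → trans (+-comm _ _) (+-congˡ (*-comm _ _))) ⟩
    f ((λ r → sum (λ i → E r (suc i) * y (suc i))) ∷ᶜ A) + y zero * f (column E zero ∷ᶜ A)
      ≈⟨ +-comm _ _ ⟩
    y zero * f (column E zero ∷ᶜ A) + f ((λ r → sum (λ i → E r (suc i) * y (suc i))) ∷ᶜ A)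
      ≈⟨ +-congˡ (expand-head alt (tailᶜ E) (tail y) A) ⟩
    sum (λ i → y i * f (column E i ∷ᶜ A))  ∎

  -- Expanding f along the first column of E ⊗ A yields det Aᵀ rather than det A, because det is
  -- defined by expansion along the first row.  The case f = det, E = 1 shows that they agree.
  alternating-⊗-detᵀ : ∀ {k n} {f : RectMatrix k n → Carrier} → IsAlternating f →
                       ∀ E (A : Matrix n) → f (E ⊗ A) ≈ f E * det (flip A)
  alternating-⊗-detᵀ {n = zero} alt E A = trans (cong alt (λ r ())) (sym (*-identityʳ _))
  alternating-⊗-detᵀ {n = suc n} {f} alt E A = begin
    f (E ⊗ A)                                          ≈⟨ cong alt (∷ᶜ-η (E ⊗ A)) ⟩
    f (column (E ⊗ A) zero ∷ᶜ rest)                    ≈⟨ expand-head alt E (λ i → A i zero) rest ⟩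
    sum (λ i → A i zero * f (column E i ∷ᶜ rest))      ≈⟨ sum-cong-≋ (λ i → *-congˡ {A i zero} (term i)) ⟩
    sum (λ i → A i zero * (s i * f E * d i))
      ≈⟨ sum-cong-≋ (λ i → solve 4 (λ a s e d → a :* (s :* e :* d) := e :* (s :* (a :* d)))
           refl (A i zero) (s i) (f E) (d i)) ⟩
    sum (λ i → f E * (s i * (A i zero * d i)))
      ≈⟨ *-distribˡ-sum (f E) (λ i → s i * (A i zero * d i)) ⟨
    f E * det (flip A)                                 ∎
    where
    rest = tailᶜ (E ⊗ A)
    s d : Fin (suc n) → Carrier
    s i = (- 1#) ^ toℕ i
    d i = det (minor (flip A) i)
    E′ : Fin (suc n) → RectMatrix _ n
    E′ i r = removeAt (E r) i
    term : ∀ i → f (column E i ∷ᶜ rest) ≈ s i * f E * d i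
    term i = begin
      f (column E i ∷ᶜ rest)
        ≈⟨ add-annihilated (prefix (column E i) alt) (column E i) (repeated-head alt (column E i))
             (λ j → A i (suc j)) (E′ i ⊗ flip (minor (flip A) i)) rest
             (λ r j → begin
               rest r j                      ≈⟨ sum-remove {i = i} (λ l → E r l * A l (suc j)) ⟩
               E r i * A i (suc j) + (E′ i ⊗ flip (minor (flip A) i)) r j   ≈⟨ +-comm _ _ ⟩
               (E′ i ⊗ flip (minor (flip A) i)) r j + E r i * A i (suc j)   ≈⟨ +-congˡ (*-comm _ _) ⟩
               (E′ i ⊗ flip (minor (flip A) i)) r j + A i (suc j) * E r i   ∎) ⟩
      f (column E i ∷ᶜ E′ i ⊗ flip (minor (flip A) i))
        ≈⟨ alternating-⊗-detᵀ (prefix (column E i) alt) (E′ i) (flip (minor (flip A) i)) ⟩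
      f (column E i ∷ᶜ E′ i) * d i
        -- Returning column i to its own place rebuilds E and produces the cofactor sign.
        ≈⟨ *-congʳ (move-head alt i (column E i) (E′ i)) ⟩
      s i * f (insertColumn (E′ i) i (column E i)) * d i
        ≈⟨ *-congʳ (*-congˡ (cong alt (λ r j → reflexive (insertAt-removeAt (E r) i j)))) ⟩
      s i * f E * d i ∎

  -- Unitriangular matrices, the identity and the transpose.

  -- Deleting a column other than the first keeps the first column, which is zero below the top row.
  minor-singular : ∀ {n} (A : Matrix (suc n)) → (∀ i → A (suc i) zero ≈ 0#) →
                   ∀ l → det (minor A (suc l)) ≈ 0#
  minor-singular {suc n} A Aₛ₀≈0 l =
    zero-column det-isAlternating (minor A (suc l)) zero Aₛ₀≈0

  -- The first row may be nonzero throughout, but every cofactor except the first has a zero column.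
  det-unitriangular : ∀ {n} (A : Matrix n) → (∀ i → A i i ≈ 1#) →
                      (∀ i j → j Fin.< i → A i j ≈ 0#) → det A ≈ 1#
  det-unitriangular {zero}  A diag below = refl
  det-unitriangular {suc n} A diag below = begin
    det A
      ≈⟨ +-cong (*-identityˡ _) (sum-zero (λ l → trans
           (*-congˡ {(- 1#) ^ toℕ (suc l)}
             (trans (*-congˡ {A zero (suc l)} (minor-singular A first-column l)) (zeroʳ _)))
           (zeroʳ _))) ⟩
    A zero zero * det (minor A zero) + 0#  ≈⟨ +-identityʳ _ ⟩
    A zero zero * det (minor A zero)
      ≈⟨ *-cong (diag zero) (det-unitriangular (minor A zero) (diag ∘ suc)
           (λ i j j<i → below (suc i) (suc j) (s≤s j<i))) ⟩
    1# * 1#                                ≈⟨ *-identityˡ 1# ⟩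
    1#                                     ∎
    where
    first-column : ∀ i → A (suc i) zero ≈ 0#
    first-column i = below (suc i) zero (s≤s z≤n)

  𝟙 : ∀ {p} {P : Set p} → Dec P → Carrier
  𝟙 P? = if does P? then 1# else 0#

  𝟙-yes : ∀ {p} {P : Set p} (P? : Dec P) → P → 𝟙 P? ≈ 1#
  𝟙-yes (yes _) _ = refl
  𝟙-yes (no ¬p) p = contradiction p ¬p

  𝟙-no : ∀ {p} {P : Set p} (P? : Dec P) → ¬ P → 𝟙 P? ≈ 0#
  𝟙-no (yes p) ¬p = contradiction p ¬p
  𝟙-no (no _)  _  = refl

  identity : ∀ {n} → Matrix n
  identity i j = 𝟙 (i ≟ j)

  sum-identity : ∀ {n} (i : Fin n) (y : Vector Carrier n) → sum (λ l → identity i l * y l) ≈ y i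
  sum-identity {suc n} i y = begin
    sum (λ l → identity i l * y l)       ≈⟨ sum-remove {i = i} (λ l → identity i l * y l) ⟩
    identity i i * y i + sum (λ l → identity i (punchIn i l) * y (punchIn i l))
      ≈⟨ +-cong (*-congʳ (𝟙-yes (i ≟ i) ≡.refl)) (sum-zero (λ l → trans
           (*-congʳ (𝟙-no (i ≟ punchIn i l) (punchInᵢ≢i i l ∘ ≡.sym))) (zeroˡ _))) ⟩
    1# * y i + 0#                        ≈⟨ +-identityʳ _ ⟩
    1# * y i                             ≈⟨ *-identityˡ _ ⟩
    y i                                  ∎

  det-identity : ∀ {n} → det (identity {n}) ≈ 1#
  det-identity {n} = det-unitriangular (identity {n}) (λ i → 𝟙-yes (i ≟ i) ≡.refl)
    (λ i j j<i → 𝟙-no (i ≟ j) (ℕ.<⇒≢ j<i ∘ ≡.cong toℕ ∘ ≡.sym))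

  det-transpose : ∀ {n} (A : Matrix n) → det A ≈ det (flip A)
  det-transpose {n} A = begin
    det A                        ≈⟨ det-cong (λ i j → sum-identity i (column A j)) ⟨
    det (identity ⊗ A)           ≈⟨ alternating-⊗-detᵀ det-isAlternating identity A ⟩
    det (identity {n}) * det (flip A)  ≈⟨ *-congʳ (det-identity {n}) ⟩
    1# * det (flip A)            ≈⟨ *-identityˡ _ ⟩
    det (flip A)                 ∎

  alternating-⊗ : ∀ {k n} {f : RectMatrix k n → Carrier} → IsAlternating f →
                  ∀ E (A : Matrix n) → f (E ⊗ A) ≈ f E * det A
  alternating-⊗ alt E A =
    trans (alternating-⊗-detᵀ alt E A) (*-congˡ (sym (det-transpose A)))

  -- Extracting the determinants of a family of matrices.

  -- The matrices are replaced by the identity one after another, each leaving its determinant as a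
  -- factor. In the second hypothesis, Z is Y with its matrix at q so replaced, described by
  -- relations instead of an update.
  product-factor : ∀ {m n} (f : (Fin m → Matrix n) → Carrier) →
    (∀ {Y Z} → (∀ q → Y q ≋ Z q) → f Y ≈ f Z) →
    (∀ q Y Z → (∀ p → p ≢ q → Y p ≋ Z p) → Z q ≋ identity → f Y ≈ f Z * det (Y q)) →
    ∀ Y → f Y ≈ f (λ _ → identity) * product (λ q → det (Y q))
  product-factor {zero}  f f-cong factor Y = trans (f-cong (λ ())) (sym (*-identityʳ _))
  product-factor {suc m} f f-cong factor Y = begin
    f Y
      ≈⟨ factor zero Y (identity ∷ tail Y)
           (λ { zero 0≢0 → contradiction ≡.refl 0≢0 ; (suc p) _ _ _ → refl }) (λ _ _ → refl) ⟩
    f (identity ∷ tail Y) * det (Y zero)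
      -- The induction runs on f with its first matrix fixed as the identity.
      ≈⟨ *-congʳ (product-factor (λ Z → f (identity ∷ Z))
           (λ Y≋Z → f-cong (λ { zero _ _ → refl ; (suc q) → Y≋Z q }))
           (λ q Y Z Y~Z → factor (suc q) (identity ∷ Y) (identity ∷ Z)
             (λ { zero _ _ _ → refl ; (suc p) p≢q → Y~Z p (p≢q ∘ ≡.cong suc) }))
           (tail Y)) ⟩
    f (identity ∷ λ _ → identity) * product (λ q → det (tail Y q)) * det (Y zero)
      ≈⟨ *-congʳ (*-congʳ (f-cong (λ { zero _ _ → refl ; (suc q) _ _ → refl }))) ⟩
    f (λ _ → identity) * product (λ q → det (tail Y q)) * det (Y zero)  ≈⟨ *-assoc _ _ _ ⟩
    f (λ _ → identity) * (product (λ q → det (tail Y q)) * det (Y zero))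
      ≈⟨ *-congˡ (*-comm _ _) ⟩
    f (λ _ → identity) * product (λ q → det (Y q)) ∎

  -- The block matrix of column differences and its determinant.

  module Blocks (N m : ℕ) where

    block : Fin (N ℕ.* m) → Fin N
    block = quotient {N} m

    position : Fin (N ℕ.* m) → Fin m
    position = remainder {N} m

    index : Fin N → Fin m → Fin (N ℕ.* m)
    index = combine

    index-block-position : ∀ i → index (block i) (position i) ≡ i
    index-block-position = combine-remQuot {N} m

    block-index : ∀ s q → block (index s q) ≡ s
    block-index s q = ≡.cong proj₁ (remQuot-combine s q)

    position-index : ∀ s q → position (index s q) ≡ q
    position-index s q = ≡.cong proj₂ (remQuot-combine {N} s q)

    index-monoʳ-≤ : ∀ s {p q} → p Fin.≤ q → index s p Fin.≤ index s q
    index-monoʳ-≤ s {p} {q} p≤q =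
      ≡.subst₂ ℕ._≤_ (≡.sym (toℕ-combine s p)) (≡.sym (toℕ-combine s q))
        (ℕ.+-monoʳ-≤ (m ℕ.* toℕ s) p≤q)

    index-monoʳ-< : ∀ s {p q} → p Fin.< q → index s p Fin.< index s q
    index-monoʳ-< s {p} {q} p<q =
      ≡.subst₂ ℕ._<_ (≡.sym (toℕ-combine s p)) (≡.sym (toℕ-combine s q))
        (ℕ.+-monoʳ-< (m ℕ.* toℕ s) p<q)

    -- For Z = `X x` this is B after the column subtractions. It is defined for any family, so that
    -- each matrix can be exchanged for the identity separately.
    staircase : (Fin m → Matrix N) → Matrix (N ℕ.* m)
    staircase Z i j = 𝟙 (position i ≤? position j) * Z (position j) (block i) (block j)

    -- Off-diagonal blocks vanish, and each diagonal block has ones on and above its diagonal and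
    -- zeros below.
    det-staircase-identity : det (staircase (λ _ → identity)) ≈ 1#
    det-staircase-identity = det-unitriangular _ diag below
      where
      diag : ∀ i → staircase (λ _ → identity) i i ≈ 1#
      diag i = trans
        (*-cong (𝟙-yes (position i ≤? position i) ℕ.≤-refl) (𝟙-yes (block i ≟ block i) ≡.refl))
        (*-identityˡ 1#)
      below : ∀ i j → j Fin.< i → staircase (λ _ → identity) i j ≈ 0#
      below i j j<i with block i ≟ block j
      ... | no _ = zeroʳ _
      -- Within one block the order of indices is that of positions, so j < i excludes `position i`
      -- ≤ `position j`.
      ... | yes eq = trans (*-congʳ (𝟙-no (position i ≤? position j) λ i≤j → ℕ.<⇒≱ j<i
              (≡.subst₂ Fin._≤_ (index-block-position i)
                (≡.trans (≡.cong (λ s → index s (position j)) eq) (index-block-position j))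
                (index-monoʳ-≤ (block i) i≤j)))) (zeroˡ _)

    -- Treats the N columns at position q, one in each block, as variables, with all other columns
    -- fixed by M. This makes the determinant an alternating function of N columns.
    replace : Fin m → Matrix (N ℕ.* m) → RectMatrix (N ℕ.* m) N → Matrix (N ℕ.* m)
    replace q M Y i j = if does (position j ≟ q) then Y i (block j) else M i j

    replace-index : ∀ q M Y i s → replace q M Y i (index s q) ≡ Y i s
    replace-index q M Y i s with position (index s q) ≟ q
    ... | yes _  = ≡.cong (Y i) (block-index s q)
    ... | no ≢q  = contradiction (position-index s q) ≢q

    replace-off : ∀ q M {Y Z} p → (∀ i s → s ≢ p → Y i s ≈ Z i s) →
                  ∀ i j → j ≢ index p q → replace q M Y i j ≈ replace q M Z i j
    replace-off q M p Y~Z i j j≢ with position j ≟ q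
    ... | no _       = refl
    ... | yes ≡.refl = Y~Z i (block j) (λ { ≡.refl → j≢ (≡.sym (index-block-position j)) })

    replace-isAlternating : ∀ q M → IsAlternating (λ Y → det (replace q M Y))
    replace-isAlternating q M .cong {Y} {Z} Y≋Z = det-cong replaced
      where
      replaced : replace q M Y ≋ replace q M Z
      replaced i j with does (position j ≟ q)
      ... | true  = Y≋Z i (block j)
      ... | false = refl
    replace-isAlternating q M .linear p x A B C A~B A~C Aₚ =
      det-linear (index p q) x _ _ _ (replace-off q M p A~B) (replace-off q M p A~C) λ i → begin
        replace q M A i (index p q)  ≡⟨ replace-index q M A i p ⟩
        A i p                        ≈⟨ Aₚ i ⟩
        B i p + x * C i p
          ≡⟨ ≡.cong₂ (λ b c → b + x * c) (replace-index q M B i p) (replace-index q M C i p) ⟨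
        replace q M B i (index p q) + x * replace q M C i (index p q)  ∎
    replace-isAlternating q M .adjacent Y {p} {p′} eq Yₚ≈Yₚ′ =
      -- Neighbouring columns of Y land m places apart, so equality of columns at any distance is
      -- needed here.
      repeated-column det-isAlternating _
        (Fin.combine-monoˡ-< q q (ℕ.≤-reflexive (≡.sym eq))) λ i → begin
        replace q M Y i (index p q)   ≡⟨ replace-index q M Y i p ⟩
        Y i p                         ≈⟨ Yₚ≈Yₚ′ i ⟩
        Y i p′                        ≡⟨ replace-index q M Y i p′ ⟨
        replace q M Y i (index p′ q)  ∎

    -- The columns of `staircase Y` at position q form the product of E and `Y q`, where E consists
    -- of the same columns of `staircase Z`; `alternating-⊗` in these N columns splits off the
    -- determinant.
    det-staircase-factor : ∀ q Y Z → (∀ p → p ≢ q → Y p ≋ Z p) → Z q ≋ identity →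
                           det (staircase Y) ≈ det (staircase Z) * det (Y q)
    det-staircase-factor q Y Z Y~Z Z≋1 = begin
      det (staircase Y)                           ≈⟨ det-cong Y-columns ⟩
      det (replace q (staircase Z) (E ⊗ Y q))     ≈⟨ alternating-⊗ (replace-isAlternating q _) E (Y q) ⟩
      det (replace q (staircase Z) E) * det (Y q) ≈⟨ *-congʳ (det-cong Z-columns) ⟩
      det (staircase Z) * det (Y q)               ∎
      where
      E : RectMatrix (N ℕ.* m) N
      E i s = 𝟙 (position i ≤? q) * identity (block i) s
      Y-columns : staircase Y ≋ replace q (staircase Z) (E ⊗ Y q)
      Y-columns i j with position j ≟ q
      ... | no ≢q      = *-congˡ (Y~Z (position j) ≢q _ _)
      ... | yes ≡.refl = begin
        e * y (block i)                             ≈⟨ *-congˡ (sum-identity (block i) y) ⟨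
        e * sum (λ s → identity (block i) s * y s)
          ≈⟨ *-distribˡ-sum e (λ s → identity (block i) s * y s) ⟩
        sum (λ s → e * (identity (block i) s * y s))
          ≈⟨ sum-cong-≋ (λ s → sym (*-assoc e (identity (block i) s) (y s))) ⟩
        (E ⊗ Y q) i (block j)                       ∎
        where
        e = 𝟙 (position i ≤? position j)
        y = column (Y q) (block j)
      Z-columns : replace q (staircase Z) E ≋ staircase Z
      Z-columns i j with position j ≟ q
      ... | no _       = refl
      ... | yes ≡.refl = *-congˡ (sym (Z≋1 (block i) (block j)))

    det-staircase : ∀ Z → det (staircase Z) ≈ product (λ q → det (Z q))
    det-staircase Z = begin
      det (staircase Z)
        ≈⟨ product-factor (λ Y → det (staircase Y))
             (λ Y≋Z → det-cong (λ i j → *-congˡ (Y≋Z (position j) (block i) (block j))))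
             det-staircase-factor Z ⟩
      det (staircase (λ _ → identity)) * product (λ q → det (Z q))  ≈⟨ *-congʳ det-staircase-identity ⟩
      1# * product (λ q → det (Z q))                                ≈⟨ *-identityˡ _ ⟩
      product (λ q → det (Z q))                                     ∎

  -- Column differences of B.

  extend-inject₁ : ∀ {m} (x : Vector Carrier m) q → extend x (inject₁ q) ≡ x q
  extend-inject₁ x zero    = ≡.refl
  extend-inject₁ x (suc q) = extend-inject₁ (tail x) q

  -- The successor of q within `Fin m` exists only when q is not last, so it is supplied as `q′` and
  -- identified by its value.
  extend-suc : ∀ {m} (x : Vector Carrier m) {q q′} → toℕ q′ ≡ suc (toℕ q) → extend x (suc q) ≡ x q′
  extend-suc x {zero}  {suc zero} eq = ≡.refl
  extend-suc x {suc q} {suc q′}   eq = extend-suc (tail x) (ℕ.suc-injective eq)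

  extend-fromℕ : ∀ {m} (x : Vector Carrier m) → extend x (fromℕ m) ≡ 0#
  extend-fromℕ {m} x = insertAt-lookup x (fromℕ m) 0#

  module _ (N m : ℕ) (x : Fin N → Fin N → Vector Carrier m) where

    open Blocks N m
    open Max (≤-totalOrder m) using (x≤y⇒x⊔y≈y; x≤y⇒y⊔x≈y) renaming (_⊔_ to _⊔ᶠ_)

    -- Subtracting the next column of the same block turns an entry into the difference of its
    -- values at max(p,q) and max(p,q+1). This is the entry of X for p ≤ q, and 0 for p > q, where
    -- both maxima are p.
    staircase-column : ∀ j → (∀ i → staircase (X x) i j ≈ B N m x i j) ⊎
      (∃ λ j′ → j Fin.< j′ × ∃ λ a → ∀ i → staircase (X x) i j ≈ B N m x i j + a * B N m x i j′)
    staircase-column j with suc (toℕ (position j)) ℕ.<? m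
    -- At the last position of a block nothing is subtracted: the convention that the value after
    -- the last is 0 makes the column of B already the required one.
    ... | no last = inj₁ entry
      where
      q = position j
      entry : ∀ i → staircase (X x) i j ≈ B N m x i j
      entry i = begin
        𝟙 (p ≤? q) * (extend y (inject₁ q) - extend y (suc q))
          ≈⟨ *-cong (𝟙-yes (p ≤? q) p≤q)
               (reflexive (≡.cong₂ (λ a b → a - b) (extend-inject₁ y q) last-zero)) ⟩
        1# * (y q - 0#)  ≈⟨ *-identityˡ _ ⟩
        y q - 0#         ≈⟨ +-congˡ -0#≈0# ⟩
        y q + 0#         ≈⟨ +-identityʳ _ ⟩
        y q              ≡⟨ ≡.cong y (x≤y⇒x⊔y≈y p≤q) ⟨
        y (p ⊔ᶠ q)       ∎
        where
        p = position i
        y = x (block i) (block j)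
        p≤q : p Fin.≤ q
        p≤q = ℕ.s≤s⁻¹ (ℕ.≤-trans (toℕ<n p) (ℕ.≮⇒≥ last))
        last-zero : extend y (suc q) ≡ 0#
        last-zero = ≡.trans
          (≡.cong (extend y) (toℕ-injective
            (≡.trans (ℕ.≤-antisym (toℕ<n q) (ℕ.≮⇒≥ last)) (≡.sym (Fin.toℕ-fromℕ m)))))
          (extend-fromℕ y)
    -- The column to subtract is the one at the next position of the same block.
    ... | yes q+1<m = inj₂ (j′ , j<j′ , - 1# , entry)
      where
      q = position j
      q′ = fromℕ< q+1<m
      q′≡ : toℕ q′ ≡ suc (toℕ q)
      q′≡ = toℕ-fromℕ< q+1<m
      q<q′ : q Fin.< q′
      q<q′ = ℕ.≤-reflexive (≡.sym q′≡)
      j′ = index (block j) q′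
      j<j′ : j Fin.< j′
      j<j′ = ≡.subst (Fin._< j′) (index-block-position j) (index-monoʳ-< (block j) q<q′)
      entry : ∀ i → staircase (X x) i j ≈ B N m x i j + - 1# * B N m x i j′
      entry i = begin
        𝟙 (p ≤? q) * (extend y (inject₁ q) - extend y (suc q))
          ≡⟨ ≡.cong₂ (λ a b → 𝟙 (p ≤? q) * (a - b)) (extend-inject₁ y q) (extend-suc y q′≡) ⟩
        𝟙 (p ≤? q) * (y q - y q′)         ≈⟨ difference ⟩
        y (p ⊔ᶠ q) - y (p ⊔ᶠ q′)          ≈⟨ +-congˡ (-1*x≈-x _) ⟨
        y (p ⊔ᶠ q) + - 1# * y (p ⊔ᶠ q′)
          ≡⟨ ≡.cong₂ (λ s t → y (p ⊔ᶠ q) + - 1# * x (block i) s (p ⊔ᶠ t))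
               (block-index (block j) q′) (position-index (block j) q′) ⟨
        B N m x i j + - 1# * B N m x i j′ ∎
        where
        p = position i
        y = x (block i) (block j)
        difference : 𝟙 (p ≤? q) * (y q - y q′) ≈ y (p ⊔ᶠ q) - y (p ⊔ᶠ q′)
        difference with p ≤? q
        ... | yes p≤q = begin
          𝟙 (p ≤? q) * (y q - y q′)  ≈⟨ *-congʳ (𝟙-yes (p ≤? q) p≤q) ⟩
          1# * (y q - y q′)          ≈⟨ *-identityˡ _ ⟩
          y q - y q′
            ≡⟨ ≡.cong₂ (λ a b → y a - y b)
                 (x≤y⇒x⊔y≈y p≤q) (x≤y⇒x⊔y≈y (ℕ.≤-trans p≤q (ℕ.<⇒≤ q<q′))) ⟨
          y (p ⊔ᶠ q) - y (p ⊔ᶠ q′)   ∎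
        ... | no p≰q = begin
          𝟙 (p ≤? q) * (y q - y q′)  ≈⟨ *-congʳ (𝟙-no (p ≤? q) p≰q) ⟩
          0# * (y q - y q′)          ≈⟨ zeroˡ _ ⟩
          0#                         ≈⟨ -‿inverseʳ (y p) ⟨
          y p - y p
            ≡⟨ ≡.cong₂ (λ a b → y a - y b) (x≤y⇒y⊔x≈y (ℕ.<⇒≤ q<p)) (x≤y⇒y⊔x≈y q′≤p) ⟨
          y (p ⊔ᶠ q) - y (p ⊔ᶠ q′)   ∎
          where
          q<p : q Fin.< p
          q<p = ℕ.≰⇒> p≰q
          q′≤p : q′ Fin.≤ p
          -- As `q′` is the successor of q, the strict inequality q < p says exactly this.
          q′≤p = ≡.subst (ℕ._≤ toℕ p) (≡.sym q′≡) q<p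

    det-B : det (B N m x) ≈ product (λ i → det (X x i))
    det-B = begin
      det (B N m x)
        ≈⟨ add-later-columns det-isAlternating (B N m x) (staircase (X x)) staircase-column ⟨
      det (staircase (X x))        ≈⟨ det-staircase (X x) ⟩
      product (λ i → det (X x i))  ∎

theorem2p2 : ∀ {c ℓ} (R : CommutativeRing c ℓ) →
    let open CommutativeRing R in
    let open Matrices R in
    (N m : ℕ) → 2 ≤ N → 1 ≤ m →
    (x : Fin N → Fin N → Vector Carrier m) →
    det (B N m x) ≈ product (λ i → det (X x i))
theorem2p2 R N m _ _ x = Determinants.det-B R N m x
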